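{- For every integer $r\geq 2$, $$\sum_{M\geq1}h_r(M)z^M=\frac{z+z^2+\cdots+z^{r-1}}{1-z-z^2-\cdots-z^r}.$$
   Context: The perimeter of a nonempty partition $\lambda$ with largest part $\lambda_1$ and $\ell(\lambda)$ parts is $\lambda_1+\ell(\lambda)-1$. For $r\geq2$, $h_r(M)$ is the number of partitions with perimeter $M$ in which every part value occurs fewer than $r$ times. -}

module Defs where

import Algebra.Properties.CommutativeMonoid.Sum as Sum
open import Data.Bool.Base using (if_then_else_)
open import Data.Fin.Base using (toℕ)
open import Data.Integer.Base as ℤ using (ℤ; +_)
import Data.Integer.Properties as ℤ
open import Data.List.Base using (List; []; _∷_; length; upTo; filter; cartesianProductWith)
open import Data.List.Membership.Propositional using (_∈_)
open import Data.List.Membership.Propositional.Properties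
  using (∈-cartesianProductWith⁺; ∈-cartesianProductWith⁻; ∈-upTo⁺; ∈-filter⁺; ∈-filter⁻)
open import Data.List.NonEmpty.Base as List⁺ using (List⁺; _∷_; toList)
open import Data.List.Properties using (∷-injective)
open import Data.List.Relation.Unary.All as All using (All; []; _∷_; all?)
open import Data.List.Relation.Unary.AllPairs as AllPairs using ([]; _∷_)
open import Data.List.Relation.Unary.Any using (here; there)
open import Data.List.Relation.Unary.Linked using (Linked; linked?)
open import Data.List.Relation.Unary.Linked.Properties using (Linked⇒AllPairs)
open import Data.List.Relation.Unary.Unique.Propositional using (Unique)
import Data.List.Relation.Unary.Unique.Propositional.Properties as Unique
open import Data.Nat.Base using (ℕ; zero; suc; _+_; _∸_; _≤_; _<_; _≥_; z≤n; s≤s)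
open import Data.Nat.Properties
  using (_≟_; _≤?_; _≥?_; _<?_; ≤-trans; ≤-reflexive; m≤m+n; m≤n+m; +-suc)
open import Data.Product.Base using (_×_; _,_; ∃-syntax; proj₁; proj₂)
open import Function.Bundles using (_⇔_; mk⇔)
open import Relation.Binary.PropositionalEquality using (_≡_; _≢_; refl; sym; trans; cong)
open import Relation.Nullary using (does)
open import Relation.Nullary.Decidable using (_×-dec_)
open import Relation.Unary using (Decidable)

open Sum ℤ.+-0-commutativeMonoid using (sum-syntax)

IsPartition : List⁺ ℕ → Set
IsPartition p = All (1 ≤_) (toList p) × Linked _≥_ (toList p)

-- Parts are listed in weakly decreasing order, so the head is the largest.
perimeter : List⁺ ℕ → ℕ
perimeter p = List⁺.head p + List⁺.length p ∸ 1

multiplicity : ℕ → List⁺ ℕ → ℕ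
multiplicity v p = length (filter (v ≟_) (toList p))

MultiplicitiesBelow : ℕ → List⁺ ℕ → Set
MultiplicitiesBelow r p = All (λ v → multiplicity v p < r) (toList p)

Counted : (r M : ℕ) → List⁺ ℕ → Set
Counted r M p = IsPartition p × perimeter p ≡ M × MultiplicitiesBelow r p

counted? : ∀ r M → Decidable (Counted r M)
counted? r M p =
  (all? (1 ≤?_) (toList p) ×-dec linked? _≥?_ (toList p))
  ×-dec (perimeter p ≟ M)
  ×-dec all? (λ v → multiplicity v p <? r) (toList p)

listsUpTo : {A : Set} → List A → ℕ → List (List A)
listsUpTo xs zero    = [] ∷ []
listsUpTo xs (suc n) = [] ∷ cartesianProductWith _∷_ xs (listsUpTo xs n)

-- A finite list containing every partition of perimeter M (along with other
-- lists); see ∈-countedPartitions below.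
candidates : ℕ → List (List⁺ ℕ)
candidates M = cartesianProductWith _∷_ (upTo (suc M)) (listsUpTo (upTo (suc M)) M)

countedPartitions : (r M : ℕ) → List (List⁺ ℕ)
countedPartitions r M = filter (counted? r M) (candidates M)

h : (r M : ℕ) → ℕ
h r M = length (countedPartitions r M)

-- countedPartitions r M lists exactly the partitions satisfying Counted r M,
-- each once, so h r M is their number.

listsUpTo-unique : ∀ {A : Set} {xs : List A} → Unique xs → ∀ n → Unique (listsUpTo xs n)
listsUpTo-unique u zero    = [] ∷ []
listsUpTo-unique {xs = xs} u (suc n) =
  All.tabulate (λ {ys} → nonempty xs {ys}) ∷
  Unique.cartesianProductWith⁺ _∷_ ∷-injective u (listsUpTo-unique u n)
  where
  nonempty : ∀ zs {ys} → ys ∈ cartesianProductWith _∷_ zs (listsUpTo xs n) → [] ≢ ys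
  nonempty zs m eq with ∈-cartesianProductWith⁻ _∷_ zs (listsUpTo xs n) m
  nonempty zs m refl | _ , _ , _ , _ , ()

∈-listsUpTo : ∀ {A : Set} {xs ys : List A} n → All (_∈ xs) ys → length ys ≤ n → ys ∈ listsUpTo xs n
∈-listsUpTo zero    []       _         = here refl
∈-listsUpTo (suc n) []       _         = here refl
∈-listsUpTo (suc n) (y ∷ ys) (s≤s len) = there (∈-cartesianProductWith⁺ _∷_ y (∈-listsUpTo n ys len))

countedPartitions-unique : ∀ r M → Unique (countedPartitions r M)
countedPartitions-unique r M =
  Unique.filter⁺ (counted? r M)
    (Unique.cartesianProductWith⁺ _∷_ (λ { refl → refl , refl })
      (Unique.upTo⁺ (suc M)) (listsUpTo-unique (Unique.upTo⁺ (suc M)) M))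

∈-candidates : ∀ {r M p} → Counted r M p → p ∈ candidates M
∈-candidates {M = M} {p = x ∷ xs} ((_ , dec) , per , _) =
  ∈-cartesianProductWith⁺ _∷_ (∈-upTo⁺ (s≤s x≤M))
    (∈-listsUpTo M (All.map (λ y≤x → ∈-upTo⁺ (s≤s (≤-trans y≤x x≤M))) below) len≤M)
  where
  x+len≡M : x + length xs ≡ M
  x+len≡M = trans (sym (cong (_∸ 1) (+-suc x (length xs)))) per
  x≤M : x ≤ M
  x≤M = ≤-trans (m≤m+n x (length xs)) (≤-reflexive x+len≡M)
  len≤M : length xs ≤ M
  len≤M = ≤-trans (m≤n+m (length xs) x) (≤-reflexive x+len≡M)
  below : All (_≤ x) xs
  below = AllPairs.head (Linked⇒AllPairs (λ i≥j j≥k → ≤-trans j≥k i≥j) dec)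

∈-countedPartitions : ∀ r M p → p ∈ countedPartitions r M ⇔ Counted r M p
∈-countedPartitions r M p = mk⇔
  (λ m → proj₂ (∈-filter⁻ (counted? r M) {xs = candidates M} m))
  (λ c → ∈-filter⁺ (counted? r M) (∈-candidates c) c)

-- Formal power series over ℤ, as coefficient sequences.
Series : Set
Series = ℕ → ℤ

infix  4 _≈_ _≈_÷_
infixl 6 _⊖_
infixl 7 _⊛_

_≈_ : Series → Series → Set
F ≈ G = ∀ n → F n ≡ G n

_⊖_ : Series → Series → Series
(F ⊖ G) n = F n ℤ.- G n

_⊛_ : Series → Series → Series
(F ⊛ G) n = ∑[ i < suc n ] (F (toℕ i) ℤ.* G (n ∸ toℕ i))

z^_ : ℕ → Series
(z^ k) n = if does (n ≟ k) then + 1 else + 0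

1ₛ : Series
1ₛ = z^ 0

z+⋯+z^_ : ℕ → Series
(z+⋯+z^ m) n = ∑[ i < m ] (z^ suc (toℕ i)) n

-- F = N / D: the series D is invertible and F = N · D⁻¹.
_≈_÷_ : Series → Series → Series → Set
F ≈ N ÷ D = ∃[ D⁻¹ ] (D ⊛ D⁻¹ ≈ 1ₛ × F ≈ N ⊛ D⁻¹)

∑≥1 : (ℕ → ℕ) → Series
∑≥1 a zero    = + 0
∑≥1 a (suc n) = + a (suc n)

{-# OPTIONS --safe #-}

-- Deleting the 1s of a partition and lowering every other part by one is
-- invertible once the number m < r of deleted 1s is recorded, and it lowers the
-- perimeter by m + 1, unless the partition consists of 1s only. The partitions
-- made of 1s contribute z + ⋯ + z^(r-1), so the generating function satisfies
-- F = (z + ⋯ + z^(r-1)) + (z + ⋯ + z^r) F.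
module Submission where

open import Defs
open import Data.Nat.Base using (ℕ; _≤_; _∸_)

import Algebra.Properties.Semiring.Sum as SemiringSum
open import Data.Bool.Base using (true; false; if_then_else_)
open import Data.Empty using (⊥)
open import Data.Fin.Base as Fin using (Fin; toℕ; fromℕ<)
open import Data.Fin.Properties using (toℕ-injective; toℕ<n; toℕ-fromℕ<)
open import Data.Integer.Base as ℤ using (+_)
import Data.Integer.Properties as ℤ
open import Data.Integer.Tactic.RingSolver using (solve-∀)
open import Data.List.Base
  using (List; []; _∷_; [_]; _++_; length; map; replicate; filter; concat; tabulate)
open import Data.List.Membership.Propositional using (_∈_)
open import Data.List.Membership.Propositional.Properties
  using (∈-map⁺; ∈-map⁻; ∈-++⁺ˡ; ∈-++⁺ʳ; ∈-++⁻; ∈-concat⁺′; ∈-concat⁻′; ∈-tabulate⁺; ∈-tabulate⁻)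
open import Data.List.Membership.Propositional.Properties.WithK using (unique∧set⇒bag)
open import Data.List.NonEmpty.Base using (List⁺; _∷_; head; toList)
open import Data.List.Properties
  using (length-++; length-map; length-replicate; filter-++; filter-all; filter-none;
         ++-cancelʳ; map-injective)
open import Data.List.Relation.Binary.BagAndSetEquality using (∼bag⇒↭)
open import Data.List.Relation.Binary.Permutation.Propositional.Properties using (↭-length)
open import Data.List.Relation.Unary.All as All using (All; []; _∷_)
import Data.List.Relation.Unary.All.Properties as All
open import Data.List.Relation.Unary.AllPairs as AllPairs using (AllPairs; []; _∷_)
import Data.List.Relation.Unary.AllPairs.Properties as AllPairs
open import Data.List.Relation.Unary.Any using (here)
open import Data.List.Relation.Unary.Linked.Properties using (Linked⇒AllPairs; AllPairs⇒Linked)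
open import Data.List.Relation.Unary.Unique.Propositional using (Unique)
import Data.List.Relation.Unary.Unique.Propositional.Properties as Unique
open import Data.Nat.Base using (zero; suc; _+_; _≡ᵇ_; _<_; _≥_; z≤n; s≤s; z<s)
open import Data.Nat.Induction using (<-rec)
open import Data.Nat.Properties as ℕ using (_≟_; _<?_)
open import Data.Product.Base using (_×_; _,_; ∃-syntax)
open import Data.Sum.Base using (inj₁; inj₂)
open import Function.Base using (_∘_)
open import Function.Bundles using (Equivalence; mk⇔)
open import Relation.Binary.PropositionalEquality
  using (_≡_; _≢_; refl; sym; trans; cong; cong₂; subst; module ≡-Reasoning)
open import Relation.Nullary using (Dec; does; yes; no; contradiction)

open import Data.List.Membership.DecPropositional _≟_ using (_∈?_)
open SemiringSum ℤ.+-*-semiring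
  using (sum-syntax; sum-cong-≗; sum-replicate-zero; ∑-distrib-+; ∑-comm; *-distribʳ-sum)
open ≡-Reasoning

-- Shifted sequences and multiplication by powers of z

-- Polymorphic so that one shift serves both series, padded with 0, and sequences of lists, padded
-- with `[]`; `delay-map` passes from lists to their lengths.
delay : {A : Set} → A → ℕ → (ℕ → A) → ℕ → A
delay a zero    f n       = f n
delay a (suc k) f zero    = a
delay a (suc k) f (suc n) = delay a k f n

delay-map : ∀ {A B : Set} (g : A → B) a k f n → g (delay a k f n) ≡ delay (g a) k (g ∘ f) n
delay-map g a zero    f n       = refl
delay-map g a (suc k) f zero    = refl
delay-map g a (suc k) f (suc n) = delay-map g a k f n

delay-delay : ∀ {A : Set} (a : A) j k f n → delay a j (delay a k f) n ≡ delay a (j + k) f n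
delay-delay a zero    k f n       = refl
delay-delay a (suc j) k f zero    = refl
delay-delay a (suc j) k f (suc n) = delay-delay a j k f n

delay-cong : ∀ {A : Set} (a : A) k {f g n} → (∀ m → m ≤ n → f m ≡ g m) →
             delay a k f n ≡ delay a k g n
delay-cong a zero    {n = n}     f≡g = f≡g n ℕ.≤-refl
delay-cong a (suc k) {n = zero}  f≡g = refl
delay-cong a (suc k) {n = suc n} f≡g = delay-cong a k λ m m≤n → f≡g m (ℕ.m≤n⇒m≤1+n m≤n)

delay-suc-cong : ∀ {A : Set} (a : A) k {f g n} → (∀ m → m < n → f m ≡ g m) →
                 delay a (suc k) f n ≡ delay a (suc k) g n
delay-suc-cong a k {n = zero}  f≡g = refl
delay-suc-cong a k {n = suc n} f≡g = delay-cong a k λ m m≤n → f≡g m (s≤s m≤n)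

infixr 8 _▷_
_▷_ : ℕ → Series → Series
k ▷ F = delay (+ 0) k F

▷-∑ : ∀ k {m} (F : Fin m → Series) n →
      (k ▷ λ n → ∑[ i < m ] F i n) n ≡ ∑[ i < m ] (k ▷ F i) n
▷-∑ zero    F n           = refl
▷-∑ (suc k) {m} F zero    = sym (sum-replicate-zero m)
▷-∑ (suc k) F (suc n)     = ▷-∑ k F n

▷-+ : ∀ k F G n → (k ▷ λ n → F n ℤ.+ G n) n ≡ (k ▷ F) n ℤ.+ (k ▷ G) n
▷-+ zero    F G n       = refl
▷-+ (suc k) F G zero    = refl
▷-+ (suc k) F G (suc n) = ▷-+ k F G n

z^-▷ : ∀ k n → (z^ k) n ≡ (k ▷ 1ₛ) n
z^-▷ zero    n       = refl
z^-▷ (suc k) zero    = refl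
z^-▷ (suc k) (suc n) = z^-▷ k n

zero-⊛ : ∀ (F G : Series) → (∀ n → F n ≡ + 0) → ∀ n → (F ⊛ G) n ≡ + 0
zero-⊛ F G F≡0 n = trans
  (sum-cong-≗ {suc n} λ i → trans (cong (ℤ._* G (n ∸ toℕ i)) (F≡0 (toℕ i))) (ℤ.*-zeroˡ (G (n ∸ toℕ i))))
  (sum-replicate-zero (suc n))

-- The summand at index 0 splits off by computation. For `suc k` it vanishes, and the remaining sum
-- is the convolution with z^k one coefficient earlier.
z^-⊛ : ∀ k G n → ((z^ k) ⊛ G) n ≡ (k ▷ G) n
z^-⊛ zero    G zero    = trans (ℤ.+-identityʳ _) (ℤ.*-identityˡ (G 0))
z^-⊛ zero    G (suc n) =
  trans (cong₂ ℤ._+_ (ℤ.*-identityˡ (G (suc n))) (zero-⊛ ((z^ 0) ∘ suc) G (λ _ → refl) n))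
        (ℤ.+-identityʳ _)
z^-⊛ (suc k) G zero    = refl
z^-⊛ (suc k) G (suc n) = trans (ℤ.+-identityˡ _) (z^-⊛ k G n)

-- Multiplication by z + ⋯ + z^m as an operator

T : ℕ → Series → Series
T m G n = ∑[ i < m ] (suc (toℕ i) ▷ G) n

z+⋯+z^-⊛ : ∀ m G n → ((z+⋯+z^ m) ⊛ G) n ≡ T m G n
z+⋯+z^-⊛ m G n = begin
  ∑[ j < suc n ] ((∑[ i < m ] (z^ suc (toℕ i)) (toℕ j)) ℤ.* G (n ∸ toℕ j))
    ≡⟨ sum-cong-≗ {suc n} (λ j → *-distribʳ-sum {m} (G (n ∸ toℕ j)) (λ i → (z^ suc (toℕ i)) (toℕ j))) ⟩
  ∑[ j < suc n ] ∑[ i < m ] ((z^ suc (toℕ i)) (toℕ j) ℤ.* G (n ∸ toℕ j))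
    ≡⟨ ∑-comm {suc n} {m} (λ j i → (z^ suc (toℕ i)) (toℕ j) ℤ.* G (n ∸ toℕ j)) ⟩
  ∑[ i < m ] ((z^ suc (toℕ i)) ⊛ G) n
    ≡⟨ sum-cong-≗ {m} (λ i → z^-⊛ (suc (toℕ i)) G n) ⟩
  T m G n ∎

z+⋯+z^-T : ∀ m n → (z+⋯+z^ m) n ≡ T m 1ₛ n
z+⋯+z^-T m n = sum-cong-≗ {m} λ i → z^-▷ (suc (toℕ i)) n

-- Each shift in `T` is by at least one, so coefficient n of the result reads only earlier
-- coefficients. This makes equations of the form F = N + T F solvable by recursion on the index.
T-local : ∀ m {F G n} → (∀ k → k < n → F k ≡ G k) → T m F n ≡ T m G n
T-local m F≡G = sum-cong-≗ {m} λ i → delay-suc-cong (+ 0) (toℕ i) F≡G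

T-+ : ∀ m F G n → T m (λ n → F n ℤ.+ G n) n ≡ T m F n ℤ.+ T m G n
T-+ m F G n = trans (sum-cong-≗ {m} λ i → ▷-+ (suc (toℕ i)) F G n) (∑-distrib-+ {m} _ _)

-- Both sides expand into double sums of composed shifts, and composed shifts add their lengths.
T-comm : ∀ k m G n → T k (T m G) n ≡ T m (T k G) n
T-comm k m G n = begin
  T k (T m G) n
    ≡⟨ sum-cong-≗ {k} (λ i → ▷-∑ (suc (toℕ i)) {m} _ n) ⟩
  ∑[ i < k ] ∑[ j < m ] (suc (toℕ i) ▷ suc (toℕ j) ▷ G) n
    ≡⟨ ∑-comm {k} {m} _ ⟩
  ∑[ j < m ] ∑[ i < k ] (suc (toℕ i) ▷ suc (toℕ j) ▷ G) n
    ≡⟨ sum-cong-≗ {m} (λ j → sum-cong-≗ {k} (λ i → ▷-comm (suc (toℕ i)) (suc (toℕ j)))) ⟩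
  ∑[ j < m ] ∑[ i < k ] (suc (toℕ j) ▷ suc (toℕ i) ▷ G) n
    ≡⟨ sum-cong-≗ {m} (λ j → ▷-∑ (suc (toℕ j)) {k} _ n) ⟨
  T m (T k G) n ∎
  where
  ▷-comm : ∀ i j → (i ▷ j ▷ G) n ≡ (j ▷ i ▷ G) n
  ▷-comm i j = begin
    (i ▷ j ▷ G) n    ≡⟨ delay-delay (+ 0) i j G n ⟩
    ((i + j) ▷ G) n  ≡⟨ cong (λ k → (k ▷ G) n) (ℕ.+-comm i j) ⟩
    ((j + i) ▷ G) n  ≡⟨ delay-delay (+ 0) j i G n ⟨
    (j ▷ i ▷ G) n    ∎

-- Fixed-point equations and quotients of series

T-fixpoint-unique : ∀ m {N F G : Series} →
  (∀ n → F n ≡ N n ℤ.+ T m F n) → (∀ n → G n ≡ N n ℤ.+ T m G n) → F ≈ G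
T-fixpoint-unique m {N} {F} {G} F-fix G-fix = <-rec (λ n → F n ≡ G n) λ n F≡G → begin
  F n                ≡⟨ F-fix n ⟩
  N n ℤ.+ T m F n    ≡⟨ cong (λ t → N n ℤ.+ t) (T-local m λ k k<n → F≡G k<n) ⟩
  N n ℤ.+ T m G n    ≡⟨ G-fix n ⟨
  G n                ∎

-- Partial sums of 1 + T 1 + T² 1 + ⋯; the coefficient of zⁿ is final from the
-- n-th one on.
geometric : ℕ → ℕ → Series
geometric m zero    n = 1ₛ n
geometric m (suc k) n = 1ₛ n ℤ.+ T m (geometric m k) n

geometric-stable : ∀ m j k n → n ≤ j → n ≤ k → geometric m j n ≡ geometric m k n
geometric-stable m zero    zero    n       _   _   = refl
-- In the constant coefficient every term of `T` is a padding 0.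
geometric-stable m zero    (suc k) zero    _   _   = sym (cong (λ t → + 1 ℤ.+ t) (sum-replicate-zero m))
geometric-stable m (suc j) zero    zero    _   _   = cong (λ t → + 1 ℤ.+ t) (sum-replicate-zero m)
geometric-stable m (suc j) (suc k) n       n≤j n≤k =
  cong (λ t → 1ₛ n ℤ.+ t) (T-local m λ i i<n →
    geometric-stable m j k i (ℕ.≤-pred (ℕ.≤-trans i<n n≤j)) (ℕ.≤-pred (ℕ.≤-trans i<n n≤k)))

1/[1-z-⋯-z^_] : ℕ → Series
1/[1-z-⋯-z^ m ] n = geometric m n n

1/[1-z-⋯-z^]-fix : ∀ m n → 1/[1-z-⋯-z^ m ] n ≡ 1ₛ n ℤ.+ T m 1/[1-z-⋯-z^ m ] n
1/[1-z-⋯-z^]-fix m n = begin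
  -- One further iteration keeps coefficient n and exposes an application of `T m`.
  geometric m n n                        ≡⟨ geometric-stable m n (suc n) n ℕ.≤-refl (ℕ.n≤1+n n) ⟩
  1ₛ n ℤ.+ T m (geometric m n) n         ≡⟨ cong (λ t → 1ₛ n ℤ.+ t) (T-local m λ k k<n →
                                              geometric-stable m n k k (ℕ.<⇒≤ k<n) ℕ.≤-refl) ⟩
  1ₛ n ℤ.+ T m 1/[1-z-⋯-z^ m ] n         ∎

⊖-⊛ : ∀ (F G H : Series) n → ((F ⊖ G) ⊛ H) n ≡ (F ⊛ H) n ℤ.- (G ⊛ H) n
⊖-⊛ F G H zero    = lemma (F 0) (G 0) (H 0)
  where
  lemma : ∀ f g h → (f ℤ.- g) ℤ.* h ℤ.+ + 0 ≡ (f ℤ.* h ℤ.+ + 0) ℤ.- (g ℤ.* h ℤ.+ + 0)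
  lemma = solve-∀
⊖-⊛ F G H (suc n) = trans
  (cong (λ t → (F 0 ℤ.- G 0) ℤ.* H (suc n) ℤ.+ t) (⊖-⊛ (F ∘ suc) (G ∘ suc) H n))
  (lemma (F 0) (G 0) (H (suc n)) (((F ∘ suc) ⊛ H) n) (((G ∘ suc) ⊛ H) n))
  where
  lemma : ∀ f g h a b → (f ℤ.- g) ℤ.* h ℤ.+ (a ℤ.- b) ≡ (f ℤ.* h ℤ.+ a) ℤ.- (g ℤ.* h ℤ.+ b)
  lemma = solve-∀

-- The limit `C` of the geometric sums inverts the denominator. Applying `T k` to the equation for
-- `C` and commuting the operators shows that `T k C`, the numerator times `C`, solves the same
-- equation as `F`; uniqueness identifies the two.
fixpoint⇒quotient : ∀ k m F → (∀ n → F n ≡ (z+⋯+z^ k) n ℤ.+ T m F n) →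
                    F ≈ (z+⋯+z^ k) ÷ (1ₛ ⊖ (z+⋯+z^ m))
fixpoint⇒quotient k m F F-fix = C , inverse ,
  λ n → trans (T-fixpoint-unique m {N} F-fix TC-fix n) (sym (z+⋯+z^-⊛ k C n))
  where
  N = z+⋯+z^ k
  C = 1/[1-z-⋯-z^ m ]

  cancel : ∀ a b → (a ℤ.+ b) ℤ.- b ≡ a
  cancel = solve-∀

  inverse : (1ₛ ⊖ (z+⋯+z^ m)) ⊛ C ≈ 1ₛ
  inverse n = begin
    ((1ₛ ⊖ (z+⋯+z^ m)) ⊛ C) n              ≡⟨ ⊖-⊛ 1ₛ (z+⋯+z^ m) C n ⟩
    (1ₛ ⊛ C) n ℤ.- ((z+⋯+z^ m) ⊛ C) n      ≡⟨ cong₂ ℤ._-_ (z^-⊛ 0 C n) (z+⋯+z^-⊛ m C n) ⟩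
    C n ℤ.- T m C n                        ≡⟨ cong (ℤ._- T m C n) (1/[1-z-⋯-z^]-fix m n) ⟩
    (1ₛ n ℤ.+ T m C n) ℤ.- T m C n         ≡⟨ cancel (1ₛ n) (T m C n) ⟩
    1ₛ n                                   ∎

  TC-fix : ∀ n → T k C n ≡ N n ℤ.+ T m (T k C) n
  TC-fix n = begin
    T k C n                            ≡⟨ T-local k {n = n} (λ i _ → 1/[1-z-⋯-z^]-fix m i) ⟩
    T k (λ n → 1ₛ n ℤ.+ T m C n) n     ≡⟨ T-+ k 1ₛ (T m C) n ⟩
    T k 1ₛ n ℤ.+ T k (T m C) n         ≡⟨ cong₂ ℤ._+_ (sym (z+⋯+z^-T k n)) (T-comm k m C n) ⟩
    N n ℤ.+ T m (T k C) n              ∎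

z+⋯+z^-suc : ∀ m n → (z+⋯+z^ m) (suc n) ≡ (if does (n <? m) then + 1 else + 0)
z+⋯+z^-suc zero    n       = refl
z+⋯+z^-suc (suc m) zero    = cong (λ t → + 1 ℤ.+ t) (sum-replicate-zero m)
z+⋯+z^-suc (suc m) (suc n) = trans (ℤ.+-identityˡ _) (z+⋯+z^-suc m n)

-- Delayed sequences of lists

∈-delay⁺ : ∀ {A : Set} k {f : ℕ → List A} {m x} → x ∈ f m → x ∈ delay [] k f (k + m)
∈-delay⁺ zero    x∈ = x∈
∈-delay⁺ (suc k) x∈ = ∈-delay⁺ k x∈

∈-delay⁻ : ∀ {A : Set} k {f : ℕ → List A} {n x} → x ∈ delay [] k f n →
           ∃[ m ] (x ∈ f m × n ≡ k + m)
∈-delay⁻ zero            x∈ = _ , x∈ , refl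
∈-delay⁻ (suc k) {n = suc n} x∈ with m , x∈fm , eq ← ∈-delay⁻ k x∈ = m , x∈fm , cong suc eq

delay-unique : ∀ {A : Set} k {f : ℕ → List A} → (∀ n → Unique (f n)) → ∀ n → Unique (delay [] k f n)
delay-unique zero    u n       = u n
delay-unique (suc k) u zero    = []
delay-unique (suc k) u (suc n) = delay-unique k u n

-- Counting occurrences of a value

-- This is `multiplicity` on possibly empty lists, since deleting the 1s of a partition may leave
-- nothing.
occurrences : ℕ → List ℕ → ℕ
occurrences v xs = length (filter (v ≟_) xs)

occurrences-++ : ∀ v xs ys → occurrences v (xs ++ ys) ≡ occurrences v xs + occurrences v ys
occurrences-++ v xs ys = trans (cong length (filter-++ (v ≟_) xs ys)) (length-++ (filter (v ≟_) xs))

occurrences-∉ : ∀ {v xs} → All (v ≢_) xs → occurrences v xs ≡ 0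
occurrences-∉ v∉ = cong length (filter-none (_ ≟_) v∉)

occurrences-map-suc : ∀ v xs → occurrences (suc v) (map suc xs) ≡ occurrences v xs
occurrences-map-suc v []       = refl
occurrences-map-suc v (x ∷ xs) with v ≡ᵇ x
... | false = occurrences-map-suc v xs
... | true  = cong suc (occurrences-map-suc v xs)

occurrences-replicate : ∀ v m → occurrences v (replicate m v) ≡ m
occurrences-replicate v m =
  trans (cong length (filter-all (v ≟_) (All.replicate⁺ m refl))) (length-replicate m)

-- Bounding the occurrences of every v, not only of the parts, lets the bound be
-- checked value by value after a shift of the parts.
record Restricted (r : ℕ) (xs : List ℕ) : Set where
  constructor restricted
  field
    positive   : All (1 ≤_) xs
    decreasing : AllPairs _≥_ xs
    bounded    : ∀ v → occurrences v xs < r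

open Restricted

occurrences-0 : ∀ {xs} → All (1 ≤_) xs → occurrences 0 xs ≡ 0
occurrences-0 pos = occurrences-∉ (All.map (λ { 1≤x refl → contradiction 1≤x λ () }) pos)

-- Raising all parts and appending 1s

grow : ℕ → List ℕ → List ℕ
grow m xs = map suc xs ++ replicate m 1

occurrences-grow : ∀ v m xs →
  occurrences (suc v) (grow m xs) ≡ occurrences v xs + occurrences (suc v) (replicate m 1)
occurrences-grow v m xs = trans (occurrences-++ (suc v) (map suc xs) (replicate m 1))
  (cong (_+ occurrences (suc v) (replicate m 1)) (occurrences-map-suc v xs))

-- Raised positive parts are at least 2, so the appended 1s are the only ones and `m` can be read
-- off the result.
occurrences-1-grow : ∀ m {xs} → All (1 ≤_) xs → occurrences 1 (grow m xs) ≡ m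
occurrences-1-grow m {xs} pos = trans (occurrences-grow 0 m xs)
  (cong₂ _+_ (occurrences-0 pos) (occurrences-replicate 1 m))

-- The value 1 now occurs m < r times, and each value v + 2 occurs as often as v + 1 did before.
grow-restricted : ∀ {r m xs} → m < r → Restricted r xs → Restricted r (grow m xs)
grow-restricted {r} {m} {xs} m<r R = restricted pos dec bnd
  where
  pos : All (1 ≤_) (grow m xs)
  pos = All.++⁺ (All.map⁺ (All.universal (λ _ → s≤s z≤n) xs)) (All.replicate⁺ m ℕ.≤-refl)

  replicate-dec : ∀ m → AllPairs _≥_ (replicate m 1)
  replicate-dec zero    = []
  replicate-dec (suc m) = All.replicate⁺ m ℕ.≤-refl ∷ replicate-dec m

  dec : AllPairs _≥_ (grow m xs)
  dec = AllPairs.++⁺ (AllPairs.map⁺ (AllPairs.map s≤s (decreasing R))) (replicate-dec m)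
    (All.map⁺ (All.universal (λ _ → All.replicate⁺ m (s≤s z≤n)) xs))

  bnd : ∀ v → occurrences v (grow m xs) < r
  bnd zero          = subst (_< r) (sym (occurrences-0 pos)) (ℕ.≤-<-trans z≤n m<r)
  bnd (suc zero)    = subst (_< r) (sym (occurrences-1-grow m (positive R))) m<r
  bnd (suc (suc v)) = subst (_< r) (sym eq) (bounded R (suc v))
    where
    eq : occurrences (suc (suc v)) (grow m xs) ≡ occurrences (suc v) xs
    eq = trans (occurrences-grow (suc v) m xs)
      (trans (cong (λ t → occurrences (suc v) xs + t) (occurrences-∉ (All.replicate⁺ m λ ())))
             (ℕ.+-identityʳ _))

-- By induction on the list: a leading 1 joins the trailing 1s, and a larger head is lowered and put
-- in front of `ys`.
grow-surjective : ∀ {xs} → All (1 ≤_) xs → AllPairs _≥_ xs →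
  ∃[ m ] ∃[ ys ] (xs ≡ grow m ys × All (1 ≤_) ys × AllPairs _≥_ ys)
grow-surjective [] [] = 0 , [] , refl , [] , []
grow-surjective {suc x ∷ _} (_ ∷ pos) (x≥ ∷ dec) with grow-surjective pos dec
grow-surjective {suc zero ∷ _} (_ ∷ pos) (x≥ ∷ dec) | m , [] , refl , _ =
  suc m , [] , refl , [] , []
-- In a decreasing list no raised part, being at least 2, follows a 1.
grow-surjective {suc zero ∷ _} (_ ∷ pos) ((s≤s () ∷ _) ∷ _) | m , suc y ∷ ys , refl , _
grow-surjective {suc zero ∷ _} (_ ∷ pos) (_ ∷ dec) | m , zero ∷ ys , refl , (() ∷ _) , _
grow-surjective {suc (suc x) ∷ _} (_ ∷ pos) (x≥ ∷ dec) | m , ys , refl , pos′ , dec′ =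
  m , suc x ∷ ys , refl , s≤s z≤n ∷ pos′ ,
  All.map ℕ.≤-pred (All.map⁻ (All.++⁻ˡ (map suc ys) x≥)) ∷ dec′

grow-restricted⁻ : ∀ {r xs} → Restricted r xs →
  ∃[ m ] ∃[ ys ] (xs ≡ grow m ys × m < r × Restricted r ys)
grow-restricted⁻ {r} R with m , ys , refl , pos , dec ← grow-surjective (positive R) (decreasing R) =
  m , ys , refl ,
  subst (_< r) (occurrences-1-grow m pos) (bounded R 1) ,
  restricted pos dec λ v → ℕ.≤-<-trans
    (subst (occurrences v ys ≤_) (sym (occurrences-grow v m ys)) (ℕ.m≤m+n _ _))
    (bounded R (suc v))

-- Nonempty partitions and their perimeters

perimeter-∷ : ∀ x xs → perimeter (x ∷ xs) ≡ x + length xs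
perimeter-∷ x xs = cong (_∸ 1) (ℕ.+-suc x (length xs))

restricted⇒counted : ∀ {r p} → Restricted r (toList p) → Counted r (perimeter p) p
restricted⇒counted {p = p} R =
  (positive R , AllPairs⇒Linked (decreasing R)) , refl , All.universal (bounded R) (toList p)

counted⇒restricted : ∀ {r M p} → Counted r M p → Restricted r (toList p)
counted⇒restricted {r} {M} {p} ((pos , lnk) , _ , below) =
  restricted pos (Linked⇒AllPairs (λ i≥j j≥k → ℕ.≤-trans j≥k i≥j) lnk) bnd
  where
  bnd : ∀ v → occurrences v (toList p) < r
  bnd v with v ∈? toList p
  ... | yes v∈ = All.lookup below v∈
  -- A value that is not a part occurs 0 times, and the bound at the head of `p` gives 0 < r.
  ... | no  v∉ = subst (_< r) (sym (occurrences-∉ (All.¬Any⇒All¬ _ v∉)))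
                   (ℕ.≤-<-trans z≤n (All.head below))

grow⁺ : ℕ → List⁺ ℕ → List⁺ ℕ
grow⁺ m (x ∷ xs) = suc x ∷ grow m xs

grow⁺-injective : ∀ m {p q} → grow⁺ m p ≡ grow⁺ m q → p ≡ q
grow⁺-injective m {x ∷ xs} {y ∷ ys} eq
  with map-injective ℕ.suc-injective (++-cancelʳ (replicate m 1) (map suc (x ∷ xs)) (map suc (y ∷ ys)) (cong toList eq))
... | refl = refl

-- The largest part gains 1 and m parts are added. Partitions made of 1s only would come from the
-- empty list, which has no perimeter, and so are handled apart.
perimeter-grow⁺ : ∀ m p → perimeter (grow⁺ m p) ≡ suc (m + perimeter p)
perimeter-grow⁺ m (x ∷ xs) = begin
  perimeter (suc x ∷ grow m xs)         ≡⟨ perimeter-∷ (suc x) (grow m xs) ⟩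
  suc (x + length (grow m xs))          ≡⟨ cong (λ l → suc (x + l)) (length-++ (map suc xs)) ⟩
  suc (x + (length (map suc xs) + length (replicate m 1)))
    ≡⟨ cong₂ (λ k l → suc (x + (k + l))) (length-map suc xs) (length-replicate m) ⟩
  suc (x + (length xs + m))             ≡⟨ cong suc (ℕ.+-assoc x (length xs) m) ⟨
  suc (x + length xs + m)               ≡⟨ cong suc (ℕ.+-comm (x + length xs) m) ⟩
  suc (m + (x + length xs))             ≡⟨ cong (λ k → suc (m + k)) (perimeter-∷ x xs) ⟨
  suc (m + perimeter (x ∷ xs))          ∎

allOnes : ℕ → List⁺ ℕ
allOnes n = 1 ∷ replicate n 1

perimeter-allOnes : ∀ n → perimeter (allOnes n) ≡ suc n
perimeter-allOnes n = cong suc (length-replicate n)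

-- Lists with an optional entry and lengths of concatenations

_onlyIf_ : ∀ {A P : Set} → A → Dec P → List A
a onlyIf P? = if does P? then [ a ] else []

∈-onlyIf⁻ : ∀ {A P : Set} {a x : A} (P? : Dec P) → x ∈ a onlyIf P? → x ≡ a × P
∈-onlyIf⁻ (yes p) (here refl) = refl , p

∈-onlyIf⁺ : ∀ {A P : Set} {a : A} (P? : Dec P) → P → a ∈ a onlyIf P?
∈-onlyIf⁺ (yes _) _ = here refl
∈-onlyIf⁺ (no ¬p) p = contradiction p ¬p

onlyIf-unique : ∀ {A P : Set} {a : A} (P? : Dec P) → Unique (a onlyIf P?)
onlyIf-unique (yes _) = [] ∷ []
onlyIf-unique (no  _) = []

length-onlyIf : ∀ {A P : Set} {a : A} (P? : Dec P) →
                + length (a onlyIf P?) ≡ (if does P? then + 1 else + 0)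
length-onlyIf (yes _) = refl
length-onlyIf (no  _) = refl

length-concat-tabulate : ∀ {A : Set} m (f : Fin m → List A) →
  + length (concat (tabulate f)) ≡ ∑[ i < m ] (+ length (f i))
length-concat-tabulate zero    f = refl
length-concat-tabulate (suc m) f = begin
  + length (f Fin.zero ++ concat (tabulate (f ∘ Fin.suc)))
    ≡⟨ cong +_ (length-++ (f Fin.zero)) ⟩
  + length (f Fin.zero) ℤ.+ + length (concat (tabulate (f ∘ Fin.suc)))
    ≡⟨ cong (λ t → + length (f Fin.zero) ℤ.+ t) (length-concat-tabulate m (f ∘ Fin.suc)) ⟩
  ∑[ i < suc m ] (+ length (f i)) ∎

-- Decomposition of the counted partitions and the recurrence

module _ (s : ℕ) where

  -- Here r is `suc s`, and index `n` stands for perimeter n + 1. The n + 1 ones are allowed when n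
  -- + 1 < r, that is, n < s.
  allOnesBlock : ℕ → List (List⁺ ℕ)
  allOnesBlock n = allOnes n onlyIf (n <? s)

  -- Appending i ones to reach perimeter n + 1 starts from perimeter n - i; the delay supplies `[]`
  -- when i exceeds n. The s + 1 indices are the admissible numbers of ones, 0 up to r - 1.
  grownBlock : ℕ → Fin (suc s) → List (List⁺ ℕ)
  grownBlock n i = map (grow⁺ (toℕ i)) (delay [] (toℕ i) (countedPartitions (suc s)) n)

  blocks : ℕ → List (List⁺ ℕ)
  blocks n = allOnesBlock n ++ concat (tabulate (grownBlock n))

  ∈-grownBlock⁻ : ∀ {n i p} → p ∈ grownBlock n i →
    ∃[ q ] (p ≡ grow⁺ (toℕ i) q × Restricted (suc s) (toList q) × n ≡ toℕ i + perimeter q)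
  ∈-grownBlock⁻ {n} {i} p∈
    with q , q∈ , p≡ ← ∈-map⁻ (grow⁺ (toℕ i)) p∈
    with m , q∈m , n≡ ← ∈-delay⁻ (toℕ i) q∈
    with c@(_ , refl , _) ← Equivalence.to (∈-countedPartitions (suc s) m q) q∈m
    = q , p≡ , counted⇒restricted c , n≡

  blocks-sound : ∀ {n p} → p ∈ blocks n → Counted (suc s) (suc n) p
  blocks-sound {n} {p} p∈ with ∈-++⁻ (allOnesBlock n) p∈
  ... | inj₁ p∈ones with refl , n<s ← ∈-onlyIf⁻ (n <? s) p∈ones =
    subst (λ M → Counted (suc s) M p) (perimeter-allOnes n)
      -- The n + 1 ones arise by growing the empty list.
      (restricted⇒counted (grow-restricted {xs = []} (s≤s n<s) (restricted [] [] λ _ → z<s)))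
  ... | inj₂ p∈grown
    with _ , p∈b , b∈ ← ∈-concat⁻′ (tabulate (grownBlock n)) p∈grown
    with i , refl ← ∈-tabulate⁻ {f = grownBlock n} b∈
    with q , refl , R , refl ← ∈-grownBlock⁻ {i = i} p∈b =
    subst (λ M → Counted (suc s) M p) (perimeter-grow⁺ (toℕ i) q)
      (restricted⇒counted (grow-restricted (toℕ<n i) R))

  blocks-complete : ∀ {n p} → Counted (suc s) (suc n) p → p ∈ blocks n
  blocks-complete {n} {x ∷ xs} c@(_ , per , _) with grow-restricted⁻ (counted⇒restricted c)
  -- No raised part is present, so all parts are 1; their number is positive because the partition
  -- is nonempty.
  ... | suc m , [] , refl , s≤s m<s , _
    with refl ← ℕ.suc-injective (trans (sym (perimeter-allOnes m)) per) =
    ∈-++⁺ˡ (∈-onlyIf⁺ (m <? s) m<s)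
  ... | m , y ∷ ys , refl , m<r , R
    with refl ← ℕ.suc-injective (trans (sym (perimeter-grow⁺ m (y ∷ ys))) per) =
    ∈-++⁺ʳ (allOnesBlock _) (∈-concat⁺′ (grown m m<r) (∈-tabulate⁺ {f = grownBlock _} (fromℕ< m<r)))
    where
    grown : ∀ m (m<r : m < suc s) → grow⁺ m (y ∷ ys) ∈ grownBlock (m + perimeter (y ∷ ys)) (fromℕ< m<r)
    grown m m<r rewrite toℕ-fromℕ< m<r = ∈-map⁺ (grow⁺ m) (∈-delay⁺ m
      (Equivalence.from (∈-countedPartitions (suc s) _ (y ∷ ys)) (restricted⇒counted R)))

  -- Different grown blocks differ in their number of 1s, and every grown partition has a head of at
  -- least 2, unlike `allOnes n`.
  blocks-unique : ∀ n → Unique (blocks n)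
  blocks-unique n = Unique.++⁺ (onlyIf-unique (n <? s))
    (Unique.concat⁺
      (All.tabulate⁺ λ i → Unique.map⁺ (grow⁺-injective (toℕ i))
        (delay-unique (toℕ i) (countedPartitions-unique (suc s)) n))
      (AllPairs.tabulate⁺ grown-disjoint))
    ones-disjoint
    where
    grown-disjoint : ∀ {i j} → i ≢ j → ∀ {p} → p ∈ grownBlock n i × p ∈ grownBlock n j → ⊥
    grown-disjoint {i} {j} i≢j (p∈i , p∈j)
      with q , refl , R , _ ← ∈-grownBlock⁻ {i = i} p∈i
      with q′ , eq , R′ , _ ← ∈-grownBlock⁻ {i = j} p∈j =
      i≢j (toℕ-injective (begin
        toℕ i                                     ≡⟨ occurrences-1-grow (toℕ i) (positive R) ⟨
        occurrences 1 (toList (grow⁺ (toℕ i) q))   ≡⟨ cong (occurrences 1 ∘ toList) eq ⟩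
        occurrences 1 (toList (grow⁺ (toℕ j) q′))  ≡⟨ occurrences-1-grow (toℕ j) (positive R′) ⟩
        toℕ j                                     ∎))

    ones-disjoint : ∀ {p} → p ∈ allOnesBlock n × p ∈ concat (tabulate (grownBlock n)) → ⊥
    ones-disjoint (p∈ones , p∈grown)
      with refl , _ ← ∈-onlyIf⁻ (n <? s) p∈ones
      with _ , p∈b , b∈ ← ∈-concat⁻′ (tabulate (grownBlock n)) p∈grown
      with i , refl ← ∈-tabulate⁻ {f = grownBlock n} b∈
      with (y ∷ _) , eq , restricted (1≤y ∷ _) _ _ , _ ← ∈-grownBlock⁻ {i = i} p∈b =
      ℕ.<-irrefl (cong head eq) (s≤s 1≤y)

  -- Two duplicate-free lists with the same members are permutations of each other.
  h-blocks : ∀ n → h (suc s) (suc n) ≡ length (blocks n)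
  h-blocks n = ↭-length (∼bag⇒↭ (unique∧set⇒bag
    (countedPartitions-unique (suc s) (suc n)) (blocks-unique n)
    (λ {p} → mk⇔
      (blocks-complete ∘ Equivalence.to (∈-countedPartitions (suc s) (suc n) p))
      (Equivalence.from (∈-countedPartitions (suc s) (suc n) p) ∘ blocks-sound))))

  -- A positive head forces a positive perimeter. Hence the constant coefficient 0 fixed by `∑≥1`
  -- agrees with `h`, and the delayed lists may start at perimeter 0.
  h-zero : h (suc s) 0 ≡ 0
  h-zero with countedPartitions (suc s) 0 | ∈-countedPartitions (suc s) 0
  ... | []    | _ = refl
  ... | (x ∷ xs) ∷ _ | ∈⇔ with Equivalence.to (∈⇔ (x ∷ xs)) (here refl)
  ...   | ((s≤s _ ∷ _) , _) , per , _ = contradiction (trans (sym (perimeter-∷ x xs)) per) λ ()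

  ∑≥1-h : ∀ n → ∑≥1 (h (suc s)) n ≡ + h (suc s) n
  ∑≥1-h zero    = cong +_ (sym h-zero)
  ∑≥1-h (suc n) = refl

  length-allOnesBlock : ∀ n → + length (allOnesBlock n) ≡ (z+⋯+z^ s) (suc n)
  length-allOnesBlock n = trans (length-onlyIf (n <? s)) (sym (z+⋯+z^-suc s n))

  length-grownBlock : ∀ n i → + length (grownBlock n i) ≡ (toℕ i ▷ ∑≥1 (h (suc s))) n
  length-grownBlock n i = begin
    + length (grownBlock n i)
      ≡⟨ cong +_ (length-map (grow⁺ (toℕ i)) (delay [] (toℕ i) (countedPartitions (suc s)) n)) ⟩
    + length (delay [] (toℕ i) (countedPartitions (suc s)) n)
      ≡⟨ delay-map (+_ ∘ length) [] (toℕ i) (countedPartitions (suc s)) n ⟩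
    (toℕ i ▷ (+_ ∘ h (suc s))) n
      ≡⟨ delay-cong (+ 0) (toℕ i) {n = n} (λ m _ → ∑≥1-h m) ⟨
    (toℕ i ▷ ∑≥1 (h (suc s))) n ∎

  h-recurrence : ∀ n → ∑≥1 (h (suc s)) n ≡ (z+⋯+z^ s) n ℤ.+ T (suc s) (∑≥1 (h (suc s))) n
  h-recurrence zero    = sym (cong₂ ℤ._+_ (sum-replicate-zero s) (sum-replicate-zero (suc s)))
  h-recurrence (suc n) = begin
    + h (suc s) (suc n)
      ≡⟨ cong +_ (trans (h-blocks n) (length-++ (allOnesBlock n))) ⟩
    + length (allOnesBlock n) ℤ.+ + length (concat (tabulate (grownBlock n)))
      ≡⟨ cong₂ ℤ._+_ (length-allOnesBlock n) (length-concat-tabulate (suc s) (grownBlock n)) ⟩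
    (z+⋯+z^ s) (suc n) ℤ.+ ∑[ i < suc s ] (+ length (grownBlock n i))
      ≡⟨ cong (λ t → (z+⋯+z^ s) (suc n) ℤ.+ t) (sum-cong-≗ {suc s} (length-grownBlock n)) ⟩
    -- At `suc n` a shift by `suc (toℕ i)` computes to the shift by `toℕ i` at `n`, so the block
    -- lengths are exactly the terms of `T`.
    (z+⋯+z^ s) (suc n) ℤ.+ T (suc s) (∑≥1 (h (suc s))) (suc n) ∎

mainTheorem12 : (r : ℕ) → 2 ≤ r →
    ∑≥1 (h r) ≈ (z+⋯+z^ (r ∸ 1)) ÷ (1ₛ ⊖ (z+⋯+z^ r))
mainTheorem12 (suc s) _ = fixpoint⇒quotient s (suc s) (∑≥1 (h (suc s))) (h-recurrence s)
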